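{- Let $\mathcal{L}\in\{\mathtt{M},\mathtt{ME},\mathtt{ME}^\infty\}$. There is an effective translation $(\cdot)^\otimes$ from $\mathcal{L}(A)$-sentences to sentences of the universal fragment of $\mathcal{L}(A)$ such that a sentence $\phi\in\mathcal{L}(A)$ is preserved under taking submodels if and only if $\phi\equiv\phi^\otimes$.
   Context: Fix a finite set $A$ of monadic predicate symbols. A monadic model is $(D,V)$, $D$ a set (possibly empty), $V:A\to\wp(D)$. $\mathtt{ME}^\infty(A)$: $\varphi::=\top\mid\bot\mid a(x)\mid\neg a(x)\mid x\approx y\mid x\not\approx y\mid\varphi\vee\varphi\mid\varphi\wedge\varphi\mid\exists x.\varphi\mid\forall x.\varphi\mid\exists^\infty x.\varphi\mid\forall^\infty x.\varphi$; $\mathtt{ME}(A)$ omits $\exists^\infty,\forall^\infty$; $\mathtt{M}(A)$ additionally omits $\approx,\not\approx$. Standard semantics on nonempty models ($\exists^\infty$: infinitely many, $\forall^\infty$: all but finitely many); on the empty model $\exists,\exists^\infty$-sentences false, $\forall,\forall^\infty$-sentences true. $\equiv$: truth in the same models. $(D,V)$ is a submodel of $(D',V')$ if $D\subseteq D'$ and $V(a)=V'(a)\cap D$ for all $a$. $\phi$ is preserved under taking submodels if $\mathbb{D}\models\phi$ implies $\mathbb{D}'\models\phi$ for every submodel $\mathbb{D}'$ of $\mathbb{D}$. The universal fragment of $\mathtt{ME}^\infty(A)$: $\varphi::=\top\mid\bot\mid a(x)\mid\neg a(x)\mid x\approx y\mid x\not\approx y\mid\varphi\vee\varphi\mid\varphi\wedge\varphi\mid\forall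 x.\varphi\mid\forall^\infty x.\varphi$; for $\mathtt{ME}(A)$ omit the $\forall^\infty$ clause; for $\mathtt{M}(A)$ also omit the equality/inequality atoms. -}

module Defs where

open import Level using (0ℓ)
open import Data.Nat using (ℕ; suc)
open import Data.Fin using (Fin; zero; suc)
open import Data.Product using (Σ; _×_; _,_)
open import Data.Sum using (_⊎_)
open import Data.Unit using (⊤)
open import Data.Empty using (⊥)
open import Data.List using (List)
open import Data.List.Membership.Propositional using (_∈_)
open import Relation.Nullary using (¬_)
open import Relation.Binary.PropositionalEquality using (_≡_)
open import Function.Bundles using (_⇔_)
open import Function.Definitions using (Injective)

data Lang : Set where
  M ME MEinf : Lang

data HasEq : Lang → Set where
  me    : HasEq ME
  meinf : HasEq MEinf

data HasInf : Lang → Set where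
  meinf : HasInf MEinf

-- Formulas of L(A), with A = Fin k, and n free variables (de Bruijn, Fin n)
data Formula (L : Lang) (k : ℕ) : ℕ → Set where
  tt ff   : ∀ {n} → Formula L k n
  pos neg : ∀ {n} → Fin k → Fin n → Formula L k n
  eq neq  : ∀ {n} → HasEq L → Fin n → Fin n → Formula L k n
  or and  : ∀ {n} → Formula L k n → Formula L k n → Formula L k n
  ex all  : ∀ {n} → Formula L k (suc n) → Formula L k n
  exInf allInf : ∀ {n} → HasInf L → Formula L k (suc n) → Formula L k n

Sentence : Lang → ℕ → Set
Sentence L k = Formula L k 0

data Universal {L : Lang} {k : ℕ} : ∀ {n} → Formula L k n → Set where
  tt  : ∀ {n} → Universal {n = n} tt
  ff  : ∀ {n} → Universal {n = n} ff
  pos : ∀ {n} a (x : Fin n) → Universal (pos a x)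
  neg : ∀ {n} a (x : Fin n) → Universal (neg a x)
  eq  : ∀ {n} h (x y : Fin n) → Universal (eq h x y)
  neq : ∀ {n} h (x y : Fin n) → Universal (neq h x y)
  or  : ∀ {n} {φ ψ : Formula L k n} → Universal φ → Universal ψ → Universal (or φ ψ)
  and : ∀ {n} {φ ψ : Formula L k n} → Universal φ → Universal ψ → Universal (and φ ψ)
  all : ∀ {n} {φ : Formula L k (suc n)} → Universal φ → Universal (all φ)
  allInf : ∀ {n} h {φ : Formula L k (suc n)} → Universal φ → Universal (allInf h φ)

-- Monadic models (D, V); D is any type (possibly empty), V a ⊆ D
record Model (k : ℕ) : Set₁ where
  field
    D : Set
    V : Fin k → D → Set
open Model public

Finite : {D : Set} → (D → Set) → Set
Finite {D} S = Σ (List D) λ xs → ∀ d → S d → d ∈ xs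

extend : ∀ {n} {D : Set} → D → (Fin n → D) → Fin (suc n) → D
extend d ρ zero    = d
extend d ρ (suc i) = ρ i

Sat : ∀ {L k n} (𝔻 : Model k) → (Fin n → D 𝔻) → Formula L k n → Set
Sat 𝔻 ρ tt = ⊤
Sat 𝔻 ρ ff = ⊥
Sat 𝔻 ρ (pos a x) = V 𝔻 a (ρ x)
Sat 𝔻 ρ (neg a x) = ¬ V 𝔻 a (ρ x)
Sat 𝔻 ρ (eq _ x y) = ρ x ≡ ρ y
Sat 𝔻 ρ (neq _ x y) = ¬ (ρ x ≡ ρ y)
Sat 𝔻 ρ (or φ ψ) = Sat 𝔻 ρ φ ⊎ Sat 𝔻 ρ ψ
Sat 𝔻 ρ (and φ ψ) = Sat 𝔻 ρ φ × Sat 𝔻 ρ ψ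
Sat 𝔻 ρ (ex φ) = Σ (D 𝔻) λ d → Sat 𝔻 (extend d ρ) φ
Sat 𝔻 ρ (all φ) = ∀ d → Sat 𝔻 (extend d ρ) φ
Sat 𝔻 ρ (exInf _ φ) = ¬ Finite (λ d → Sat 𝔻 (extend d ρ) φ)
Sat 𝔻 ρ (allInf _ φ) = Finite (λ d → ¬ Sat 𝔻 (extend d ρ) φ)

noVars : {D : Set} → Fin 0 → D
noVars ()

_⊨_ : ∀ {L k} → Model k → Sentence L k → Set
𝔻 ⊨ φ = Sat 𝔻 noVars φ

-- 𝔻' is (isomorphic to) a submodel of 𝔻: an injective map f : D' → D
-- with V'(a) = V(a) ∩ D' along f
record SubmodelOf {k : ℕ} (𝔻' 𝔻 : Model k) : Set where
  field
    emb       : D 𝔻' → D 𝔻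
    injective : Injective _≡_ _≡_ emb
    respects  : ∀ a d → V 𝔻' a d ⇔ V 𝔻 a (emb d)

PreservedUnderSubmodels : ∀ {L k} → Sentence L k → Set₁
PreservedUnderSubmodels φ =
  ∀ (𝔻 𝔻' : Model _) → SubmodelOf 𝔻' 𝔻 → 𝔻 ⊨ φ → 𝔻' ⊨ φ

_≣_ : ∀ {L k} → Sentence L k → Sentence L k → Set₁
φ ≣ ψ = ∀ (𝔻 : Model _) → (𝔻 ⊨ φ) ⇔ (𝔻 ⊨ ψ)

module Submission where

-- Universal sentences are preserved under submodels, which gives one direction.
-- For the other, φ ⊗ says that φ holds in the empty model and that, for every
-- set S of types, either some type in S has only finitely many realisers, or
-- for every tuple x̄ the submodel generated by x̄ and the realisers of the types
-- in S satisfies φ. This relativisation is universal: inside that submodel the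
-- unnamed realisers of an infinite type are interchangeable, so "some" of them
-- can be replaced by "all" of them. A φ preserved under submodels holds in all
-- these generated submodels and in the empty one, hence implies φ ⊗.
-- Conversely, choose S to be the infinite types and let x̄ name q = qrank φ
-- realisers of each type (all of them when there are fewer); the generated
-- submodel then contains q copies of the type of every missing element and,
-- S being the infinite types, misses only finitely many elements, so a
-- back-and-forth argument that swaps elements of the same type transfers φ
-- from it to the whole model.

open import Defs
open import Level using (0ℓ)
open import Data.Nat using (ℕ; zero; suc; _+_; _*_; _⊔_; _≤_; _<_)
open import Data.Product using (Σ; _×_; _,_; proj₁; proj₂; uncurry)
open import Function.Bundles using (_⇔_; _↔_; Inverse; Injection; Equivalence; mk⇔; mk↔ₛ′)
open import Axiom.ExcludedMiddle using (ExcludedMiddle)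

open import Axiom.DoubleNegationElimination using (DoubleNegationElimination; em⇒dne)
open import Data.Bool using (Bool; true; false; T; _∨_; _∧_)
open import Data.Bool.Properties using (T-∨; T-∧; T-irrelevant)
open import Data.Empty using (⊥; ⊥-elim)
open import Data.Fin using (Fin; zero; suc; _↑ˡ_; _↑ʳ_; splitAt; remQuot; combine)
open import Data.Fin.Properties using (pigeonhole; <⇒≢; remQuot-combine)
open import Data.List using (List; []; _∷_; map; _++_; allFin; length; tabulate; filter; concatMap)
import Data.List as List
open import Data.List.Membership.Propositional using (_∈_; _∉_)
open import Data.List.Membership.Propositional.Properties
  using ( ∈-map⁺; ∈-map⁻; ∈-allFin; ∈-++⁺ˡ; ∈-++⁺ʳ; ∈-tabulate⁺
        ; ∈-filter⁺; ∈-filter⁻; ∈-concatMap⁺)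
open import Data.List.Relation.Unary.Any as Any using (here; there; index)
open import Data.List.Relation.Unary.Any.Properties using (lookup-index)
open import Data.Nat.Properties using (≤-refl; ≤-trans; +-monoʳ-≤; m≤m⊔n; m≤n⊔m; +-suc; m≤m+n)
open import Data.Product.Function.NonDependent.Propositional using (_×-⇔_)
open import Data.Sum using (_⊎_; inj₁; inj₂; [_,_]; [_,_]′)
open import Data.Sum.Function.Propositional using (_⊎-⇔_)
open import Data.Unit using (tt)
open import Data.Vec using (Vec; []; _∷_; lookup)
import Data.Vec as Vec
open import Data.Vec.Properties using (lookup∘tabulate)
open import Data.Vec.Functional using () renaming (_++_ to _⧺_)
open import Data.Vec.Functional.Properties using (lookup-++ˡ; lookup-++ʳ)
open import Function using (_∘_; id)
open import Function.Construct.Composition using (_⇔-∘_)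
open import Function.Construct.Identity using (⇔-id)
open import Function.Construct.Symmetry using (⇔-sym)
open import Function.Definitions using (Injective)
open import Function.Properties.Inverse using (↔⇒↣)
open import Function.Related.TypeIsomorphisms using (¬-cong-⇔)
open import Relation.Binary.PropositionalEquality
  using (_≡_; _≢_; refl; sym; trans; cong; subst; _≗_; module ≡-Reasoning)
open import Relation.Nullary using (¬_; yes; no; does)
open import Relation.Nullary.Decidable using (True; toWitness; fromWitness; isYes)
open import Relation.Unary using (Decidable)

open Equivalence using (to; from)

finite-⊆ : {A : Set} {P Q : A → Set} → (∀ a → Q a → P a) → Finite P → Finite Q
finite-⊆ Q⊆P (xs , covers) = xs , λ a q → covers a (Q⊆P a q)

finite-image : {A B : Set} {P : A → Set} {Q : B → Set} (f : A → B) →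
               (∀ b → Q b → Σ A λ a → P a × f a ≡ b) → Finite P → Finite Q
finite-image f Q⊆fP (xs , covers) = map f xs , λ b q →
  let (a , p , fa≡b) = Q⊆fP b q in subst (_∈ map f xs) fa≡b (∈-map⁺ f (covers a p))

finite-cong : {A : Set} {P Q : A → Set} → (∀ a → P a ⇔ Q a) → Finite P ⇔ Finite Q
finite-cong P⇔Q = mk⇔ (finite-⊆ (λ a → from (P⇔Q a))) (finite-⊆ (λ a → to (P⇔Q a)))

Σ-cong-⇔ : {A : Set} {P Q : A → Set} → (∀ a → P a ⇔ Q a) → Σ A P ⇔ Σ A Q
Σ-cong-⇔ P⇔Q = mk⇔ (λ (a , p) → a , to (P⇔Q a) p) (λ (a , q) → a , from (P⇔Q a) q)

Π-cong-⇔ : {A : Set} {P Q : A → Set} → (∀ a → P a ⇔ Q a) → (∀ a → P a) ⇔ (∀ a → Q a)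
Π-cong-⇔ P⇔Q = mk⇔ (λ p a → to (P⇔Q a) (p a)) (λ q a → from (P⇔Q a) (q a))

module _ {A B : Set} (f : A ↔ B) {P : A → Set} {Q : B → Set}
         (P⇔Q∘f : ∀ a → P a ⇔ Q (Inverse.to f a)) where
  open Inverse f using (strictlyInverseˡ; strictlyInverseʳ) renaming (to to f⁺; from to f⁻)

  private
    Q⇔P∘f⁻ : ∀ b → Q b ⇔ P (f⁻ b)
    Q⇔P∘f⁻ b = ⇔-sym (P⇔Q∘f (f⁻ b)) ⇔-∘ subst-⇔ (sym (strictlyInverseˡ b))
      where
      subst-⇔ : ∀ {b b'} → b ≡ b' → Q b ⇔ Q b'
      subst-⇔ refl = ⇔-id _

  Σ-⇔-along : Σ A P ⇔ Σ B Q
  Σ-⇔-along = mk⇔ (λ (a , p) → f⁺ a , to (P⇔Q∘f a) p)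
                  (λ (b , q) → f⁻ b , to (Q⇔P∘f⁻ b) q)

  Π-⇔-along : (∀ a → P a) ⇔ (∀ b → Q b)
  Π-⇔-along = mk⇔ (λ p b → from (Q⇔P∘f⁻ b) (p (f⁻ b)))
                  (λ q a → from (P⇔Q∘f a) (q (f⁺ a)))

  finite-⇔-along : Finite P ⇔ Finite Q
  finite-⇔-along = mk⇔
    (finite-image f⁺ λ b q → f⁻ b , to (Q⇔P∘f⁻ b) q , strictlyInverseˡ b)
    (finite-image f⁻ λ a p → f⁺ a , to (P⇔Q∘f a) p , strictlyInverseʳ a)

extend-∘ : ∀ {n} {A B : Set} (f : A → B) {ρ : Fin n → A} {τ : Fin n → B} →
           τ ≗ f ∘ ρ → ∀ d → extend (f d) τ ≗ f ∘ extend d ρ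
extend-∘ f τ≗fρ d zero    = refl
extend-∘ f τ≗fρ d (suc i) = τ≗fρ i

module _ {k : ℕ} {𝔼 𝔻 : Model k} (sub : SubmodelOf 𝔼 𝔻) where
  open SubmodelOf sub

  V-along : ∀ {n} a (x : Fin n) {ρ τ} → τ ≗ emb ∘ ρ → V 𝔼 a (ρ x) ⇔ V 𝔻 a (τ x)
  V-along a x τ≗ rewrite τ≗ x = respects a _

  ≡-along : ∀ {n} (x y : Fin n) {ρ τ} → τ ≗ emb ∘ ρ → (ρ x ≡ ρ y) ⇔ (τ x ≡ τ y)
  ≡-along x y τ≗ rewrite τ≗ x | τ≗ y = mk⇔ (cong emb) injective

record Isomorphism {k : ℕ} (𝔻 𝔼 : Model k) : Set where
  field
    bijection : D 𝔻 ↔ D 𝔼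
    respects  : ∀ a d → V 𝔻 a d ⇔ V 𝔼 a (Inverse.to bijection d)

  submodel : SubmodelOf 𝔻 𝔼
  submodel = record { emb = Inverse.to bijection ; injective = Injection.injective (↔⇒↣ bijection)
                    ; respects = respects }

module _ {k : ℕ} {𝔻 𝔼 : Model k} (iso : Isomorphism 𝔻 𝔼) where
  open Isomorphism iso
  open Inverse bijection using () renaming (to to f)

  sat-iso : ∀ {L n} (φ : Formula L k n) {ρ : Fin n → D 𝔻} {τ : Fin n → D 𝔼} →
            τ ≗ f ∘ ρ → Sat 𝔻 ρ φ ⇔ Sat 𝔼 τ φ
  sat-iso tt          τ≗ = ⇔-id _
  sat-iso ff          τ≗ = ⇔-id _
  sat-iso (pos a x)   τ≗ = V-along submodel a x τ≗
  sat-iso (neg a x)   τ≗ = ¬-cong-⇔ (V-along submodel a x τ≗)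
  sat-iso (eq _ x y)  τ≗ = ≡-along submodel x y τ≗
  sat-iso (neq _ x y) τ≗ = ¬-cong-⇔ (≡-along submodel x y τ≗)
  sat-iso (or φ ψ)    τ≗ = sat-iso φ τ≗ ⊎-⇔ sat-iso ψ τ≗
  sat-iso (and φ ψ)   τ≗ = sat-iso φ τ≗ ×-⇔ sat-iso ψ τ≗
  sat-iso (ex φ)      τ≗ = Σ-⇔-along bijection λ d → sat-iso φ (extend-∘ f τ≗ d)
  sat-iso (all φ)     τ≗ = Π-⇔-along bijection λ d → sat-iso φ (extend-∘ f τ≗ d)
  sat-iso (exInf _ φ) τ≗ =
    ¬-cong-⇔ (finite-⇔-along bijection λ d → sat-iso φ (extend-∘ f τ≗ d))
  sat-iso (allInf _ φ) τ≗ =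
    finite-⇔-along bijection λ d → ¬-cong-⇔ (sat-iso φ (extend-∘ f τ≗ d))

idIsomorphism : ∀ {k} (𝔻 : Model k) → Isomorphism 𝔻 𝔻
idIsomorphism 𝔻 = record
  { bijection = mk↔ₛ′ id id (λ _ → refl) (λ _ → refl) ; respects = λ _ _ → ⇔-id _ }

sat-cong : ∀ {L k n} (𝔻 : Model k) (φ : Formula L k n) {ρ τ : Fin n → D 𝔻} →
           τ ≗ ρ → Sat 𝔻 ρ φ ⇔ Sat 𝔻 τ φ
sat-cong 𝔻 φ = sat-iso (idIsomorphism 𝔻) φ

ext : ∀ {n m} → (Fin n → Fin m) → Fin (suc n) → Fin (suc m)
ext r zero    = zero
ext r (suc i) = suc (r i)

rename : ∀ {L k n m} → (Fin n → Fin m) → Formula L k n → Formula L k m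
rename r tt           = tt
rename r ff           = ff
rename r (pos a x)    = pos a (r x)
rename r (neg a x)    = neg a (r x)
rename r (eq h x y)   = eq h (r x) (r y)
rename r (neq h x y)  = neq h (r x) (r y)
rename r (or φ ψ)     = or (rename r φ) (rename r ψ)
rename r (and φ ψ)    = and (rename r φ) (rename r ψ)
rename r (ex φ)       = ex (rename (ext r) φ)
rename r (all φ)      = all (rename (ext r) φ)
rename r (exInf h φ)  = exInf h (rename (ext r) φ)
rename r (allInf h φ) = allInf h (rename (ext r) φ)

universal-rename : ∀ {L k n m} (r : Fin n → Fin m) {φ : Formula L k n} →
                   Universal φ → Universal (rename r φ)
universal-rename r tt           = tt
universal-rename r ff           = ff
universal-rename r (pos a x)    = pos a (r x)
universal-rename r (neg a x)    = neg a (r x)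
universal-rename r (eq h x y)   = eq h (r x) (r y)
universal-rename r (neq h x y)  = neq h (r x) (r y)
universal-rename r (or u v)     = or (universal-rename r u) (universal-rename r v)
universal-rename r (and u v)    = and (universal-rename r u) (universal-rename r v)
universal-rename r (all u)      = all (universal-rename (ext r) u)
universal-rename r (allInf h u) = allInf h (universal-rename (ext r) u)

extend-ext : ∀ {n m} {A : Set} (r : Fin n → Fin m) {ρ : Fin n → A} {τ : Fin m → A} →
             τ ∘ r ≗ ρ → ∀ d → extend d τ ∘ ext r ≗ extend d ρ
extend-ext r τr≗ρ d zero    = refl
extend-ext r τr≗ρ d (suc i) = τr≗ρ i

module _ {k : ℕ} (𝔻 : Model k) where
  private
    V-cong : ∀ {x y : D 𝔻} a → x ≡ y → V 𝔻 a x ⇔ V 𝔻 a y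
    V-cong a refl = ⇔-id _

    ≡-cong : ∀ {x y x' y' : D 𝔻} → x ≡ x' → y ≡ y' → (x ≡ y) ⇔ (x' ≡ y')
    ≡-cong refl refl = ⇔-id _

  sat-rename : ∀ {L n m} (φ : Formula L k n) (r : Fin n → Fin m) {ρ τ} →
               τ ∘ r ≗ ρ → Sat 𝔻 τ (rename r φ) ⇔ Sat 𝔻 ρ φ
  sat-rename tt           r τr≗ρ = ⇔-id _
  sat-rename ff           r τr≗ρ = ⇔-id _
  sat-rename (pos a x)    r τr≗ρ = V-cong a (τr≗ρ x)
  sat-rename (neg a x)    r τr≗ρ = ¬-cong-⇔ (V-cong a (τr≗ρ x))
  sat-rename (eq _ x y)   r τr≗ρ = ≡-cong (τr≗ρ x) (τr≗ρ y)
  sat-rename (neq _ x y)  r τr≗ρ = ¬-cong-⇔ (≡-cong (τr≗ρ x) (τr≗ρ y))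
  sat-rename (or φ ψ)     r τr≗ρ = sat-rename φ r τr≗ρ ⊎-⇔ sat-rename ψ r τr≗ρ
  sat-rename (and φ ψ)    r τr≗ρ = sat-rename φ r τr≗ρ ×-⇔ sat-rename ψ r τr≗ρ
  sat-rename (ex φ)       r τr≗ρ = Σ-cong-⇔ λ d → sat-rename φ (ext r) (extend-ext r τr≗ρ d)
  sat-rename (all φ)      r τr≗ρ = Π-cong-⇔ λ d → sat-rename φ (ext r) (extend-ext r τr≗ρ d)
  sat-rename (exInf _ φ)  r τr≗ρ =
    ¬-cong-⇔ (finite-cong λ d → sat-rename φ (ext r) (extend-ext r τr≗ρ d))
  sat-rename (allInf _ φ) r τr≗ρ =
    finite-cong λ d → ¬-cong-⇔ (sat-rename φ (ext r) (extend-ext r τr≗ρ d))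

zero↦ : ∀ {m} → Fin m → Fin (suc m) → Fin m
zero↦ v zero    = v
zero↦ v (suc j) = j

instantiate : ∀ {L k m} → Fin m → Formula L k (suc m) → Formula L k m
instantiate v = rename (zero↦ v)

sat-instantiate : ∀ {L k m} (𝔻 : Model k) (v : Fin m) (φ : Formula L k (suc m)) {τ} →
                  Sat 𝔻 τ (instantiate v φ) ⇔ Sat 𝔻 (extend (τ v) τ) φ
sat-instantiate 𝔻 v φ = sat-rename 𝔻 φ (zero↦ v) λ where
  zero    → refl
  (suc j) → refl

⋁ : ∀ {L k n} {A : Set} → List A → (A → Formula L k n) → Formula L k n
⋁ []       f = ff
⋁ (a ∷ as) f = or (f a) (⋁ as f)

⋀ : ∀ {L k n} {A : Set} → List A → (A → Formula L k n) → Formula L k n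
⋀ []       f = tt
⋀ (a ∷ as) f = and (f a) (⋀ as f)

module _ {L : Lang} {k n : ℕ} {A : Set} (𝔻 : Model k) {ρ : Fin n → D 𝔻} where
  sat-⋁ : (as : List A) (f : A → Formula L k n) →
          Sat 𝔻 ρ (⋁ as f) ⇔ (Σ A λ a → a ∈ as × Sat 𝔻 ρ (f a))
  sat-⋁ []       f = mk⇔ (λ ()) (λ { (_ , () , _) })
  sat-⋁ (a ∷ as) f = mk⇔
    (λ { (inj₁ s) → a , here refl , s
       ; (inj₂ s) → let (b , b∈as , t) = to (sat-⋁ as f) s in b , there b∈as , t })
    (λ { (_ , here refl , s) → inj₁ s
       ; (b , there b∈as , s) → inj₂ (from (sat-⋁ as f) (b , b∈as , s)) })

  sat-⋀ : (as : List A) (f : A → Formula L k n) →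
          Sat 𝔻 ρ (⋀ as f) ⇔ (∀ a → a ∈ as → Sat 𝔻 ρ (f a))
  sat-⋀ []       f = mk⇔ (λ _ _ ()) (λ _ → tt)
  sat-⋀ (a ∷ as) f = mk⇔
    (λ { (s , t) _ (here refl) → s ; (s , t) b (there b∈as) → to (sat-⋀ as f) t b b∈as })
    (λ g → g a (here refl) , from (sat-⋀ as f) (λ b b∈as → g b (there b∈as)))

module _ {L : Lang} {k n : ℕ} (𝔻 : Model k) {ρ : Fin n → D 𝔻} where
  sat-⋁-allFin : ∀ {m} (f : Fin m → Formula L k n) →
                 Sat 𝔻 ρ (⋁ (allFin m) f) ⇔ (Σ (Fin m) λ i → Sat 𝔻 ρ (f i))
  sat-⋁-allFin f = mk⇔ (λ s → let (i , _ , t) = to (sat-⋁ 𝔻 (allFin _) f) s in i , t)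
                       (λ (i , t) → from (sat-⋁ 𝔻 (allFin _) f) (i , ∈-allFin i , t))

  sat-⋀-allFin : ∀ {m} (f : Fin m → Formula L k n) →
                 Sat 𝔻 ρ (⋀ (allFin m) f) ⇔ (∀ i → Sat 𝔻 ρ (f i))
  sat-⋀-allFin f = mk⇔ (λ s i → to (sat-⋀ 𝔻 (allFin _) f) s i (∈-allFin i))
                       (λ g → from (sat-⋀ 𝔻 (allFin _) f) (λ i _ → g i))

universal-⋁ : ∀ {L k n} {A : Set} (as : List A) {f : A → Formula L k n} →
              (∀ a → Universal (f a)) → Universal (⋁ as f)
universal-⋁ []       u = ff
universal-⋁ (a ∷ as) u = or (u a) (universal-⋁ as u)

universal-⋀ : ∀ {L k n} {A : Set} (as : List A) {f : A → Formula L k n} →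
              (∀ a → Universal (f a)) → Universal (⋀ as f)
universal-⋀ []       u = tt
universal-⋀ (a ∷ as) u = and (u a) (universal-⋀ as u)

holdsInEmpty : ∀ {L k n} → Formula L k n → Bool
holdsInEmpty tt           = true
holdsInEmpty ff           = false
holdsInEmpty (pos _ _)    = false
holdsInEmpty (neg _ _)    = false
holdsInEmpty (eq _ _ _)   = false
holdsInEmpty (neq _ _ _)  = false
holdsInEmpty (or φ ψ)     = holdsInEmpty φ ∨ holdsInEmpty ψ
holdsInEmpty (and φ ψ)    = holdsInEmpty φ ∧ holdsInEmpty ψ
holdsInEmpty (ex _)       = false
holdsInEmpty (all _)      = true
holdsInEmpty (exInf _ _)  = false
holdsInEmpty (allInf _ _) = true

sat-empty : ∀ {L k n} (𝔻 : Model k) → ¬ D 𝔻 → (φ : Formula L k n) (ρ : Fin n → D 𝔻) →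
            Sat 𝔻 ρ φ ⇔ T (holdsInEmpty φ)
sat-empty 𝔻 ∅ tt           ρ = ⇔-id _
sat-empty 𝔻 ∅ ff           ρ = ⇔-id _
sat-empty 𝔻 ∅ (pos a x)    ρ = ⊥-elim (∅ (ρ x))
sat-empty 𝔻 ∅ (neg a x)    ρ = ⊥-elim (∅ (ρ x))
sat-empty 𝔻 ∅ (eq _ x y)   ρ = ⊥-elim (∅ (ρ x))
sat-empty 𝔻 ∅ (neq _ x y)  ρ = ⊥-elim (∅ (ρ x))
sat-empty 𝔻 ∅ (or φ ψ)     ρ = ⇔-sym T-∨ ⇔-∘ (sat-empty 𝔻 ∅ φ ρ ⊎-⇔ sat-empty 𝔻 ∅ ψ ρ)
sat-empty 𝔻 ∅ (and φ ψ)    ρ = ⇔-sym T-∧ ⇔-∘ (sat-empty 𝔻 ∅ φ ρ ×-⇔ sat-empty 𝔻 ∅ ψ ρ)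
sat-empty 𝔻 ∅ (ex φ)       ρ = mk⇔ (∅ ∘ proj₁) (λ ())
sat-empty 𝔻 ∅ (all φ)      ρ = mk⇔ _ (λ _ d → ⊥-elim (∅ d))
sat-empty 𝔻 ∅ (exInf _ φ)  ρ = mk⇔ (λ ¬fin → ¬fin ([] , λ d _ → ⊥-elim (∅ d))) (λ ())
sat-empty 𝔻 ∅ (allInf _ φ) ρ = mk⇔ _ (λ _ → [] , λ d _ → ⊥-elim (∅ d))

∅ᴹ : ∀ {k} → Model k
∅ᴹ = record { D = ⊥ ; V = λ _ _ → ⊥ }

∅ᴹ-submodel : ∀ {k} (𝔻 : Model k) → SubmodelOf ∅ᴹ 𝔻
∅ᴹ-submodel 𝔻 = record { emb = λ () ; injective = λ { {()} } ; respects = λ _ () }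

truthValue : ∀ {L k n} → Bool → Formula L k n
truthValue true  = tt
truthValue false = ff

sat-truthValue : ∀ {L k n} (𝔻 : Model k) {ρ : Fin n → D 𝔻} (b : Bool) →
                 Sat {L} 𝔻 ρ (truthValue b) ⇔ T b
sat-truthValue 𝔻 true  = ⇔-id _
sat-truthValue 𝔻 false = ⇔-id _

universal-truthValue : ∀ {L k n} (b : Bool) → Universal {L} {k} {n} (truthValue b)
universal-truthValue true  = tt
universal-truthValue false = ff

∀ⁿ : ∀ {L k} (N : ℕ) → Formula L k N → Sentence L k
∀ⁿ zero    χ = χ
∀ⁿ (suc N) χ = ∀ⁿ N (all χ)

universal-∀ⁿ : ∀ {L k} (N : ℕ) {χ : Formula L k N} → Universal χ → Universal (∀ⁿ N χ)
universal-∀ⁿ zero    u = u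
universal-∀ⁿ (suc N) u = universal-∀ⁿ N (all u)

sat-∀ⁿ : ∀ {L k} (𝔻 : Model k) (N : ℕ) (χ : Formula L k N) →
         𝔻 ⊨ ∀ⁿ N χ ⇔ (∀ xs → Sat 𝔻 xs χ)
sat-∀ⁿ 𝔻 zero    χ = Π-cong-⇔ (λ xs → sat-cong 𝔻 χ λ ()) ⇔-∘ mk⇔ (λ s _ → s) (λ s → s noVars)
sat-∀ⁿ 𝔻 (suc N) χ = mk⇔
  (λ s xs → to (sat-cong 𝔻 χ (extend-head-tail xs)) (s (xs ∘ suc) (xs zero)))
  (λ s ys d → s (extend d ys))
  ⇔-∘ sat-∀ⁿ 𝔻 N (all χ)
  where
  extend-head-tail : (xs : Fin (suc N) → D 𝔻) → xs ≗ extend (xs zero) (xs ∘ suc)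
  extend-head-tail xs zero    = refl
  extend-head-tail xs (suc i) = refl

-- The type of an element records which predicates hold at it.
Ty : ℕ → Set
Ty k = Vec Bool k

allTys : (k : ℕ) → List (Ty k)
allTys zero    = [] ∷ []
allTys (suc k) = map (true ∷_) (allTys k) ++ map (false ∷_) (allTys k)

∈-allTys : ∀ {k} (t : Ty k) → t ∈ allTys k
∈-allTys []               = here refl
∈-allTys (true ∷ t)       = ∈-++⁺ˡ (∈-map⁺ (true ∷_) (∈-allTys t))
∈-allTys {suc k} (false ∷ t) =
  ∈-++⁺ʳ (map (true ∷_) (allTys k)) (∈-map⁺ (false ∷_) (∈-allTys t))

Lit : Bool → Set → Set
Lit true  P = P
Lit false P = ¬ P

HasTy : ∀ {k} (𝔻 : Model k) → Ty k → D 𝔻 → Set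
HasTy 𝔻 t d = ∀ a → Lit (lookup t a) (V 𝔻 a d)

SameTy : ∀ {k} (𝔻 : Model k) → D 𝔻 → D 𝔻 → Set
SameTy 𝔻 d d' = ∀ a → V 𝔻 a d ⇔ V 𝔻 a d'

hasTy⇒sameTy : ∀ {k} (𝔻 : Model k) (t : Ty k) {d d'} →
               HasTy 𝔻 t d → HasTy 𝔻 t d' → SameTy 𝔻 d d'
hasTy⇒sameTy 𝔻 t t[d] t[d'] a with lookup t a | t[d] a | t[d'] a
... | true  | Vd  | Vd'  = mk⇔ (λ _ → Vd') (λ _ → Vd)
... | false | ¬Vd | ¬Vd' = mk⇔ (⊥-elim ∘ ¬Vd) (⊥-elim ∘ ¬Vd')

litFalsifying : ∀ {L k m} → Bool → Fin k → Fin m → Formula L k m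
litFalsifying true  a x = neg a x
litFalsifying false a x = pos a x

notTy : ∀ {L k m} → Ty k → Fin m → Formula L k m
notTy {k = k} t x = ⋁ (allFin k) λ a → litFalsifying (lookup t a) a x

universal-notTy : ∀ {L k m} (t : Ty k) (x : Fin m) → Universal {L} (notTy t x)
universal-notTy {k = k} t x = universal-⋁ (allFin k) λ a → universal-lit (lookup t a) a
  where
  universal-lit : ∀ b a → Universal (litFalsifying b a x)
  universal-lit true  a = neg a x
  universal-lit false a = pos a x

∀-ofTy : ∀ {L k m} → Ty k → Formula L k (suc m) → Formula L k m
∀-ofTy t χ = all (or (notTy t zero) χ)

hasInf⇒hasEq : ∀ {L} → HasInf L → HasEq L
hasInf⇒hasEq meinf = meinf

namedByContext : ∀ {L k m} → HasEq L → Formula L k (suc m)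
namedByContext {m = m} h = ⋁ (allFin m) λ v → eq h zero (suc v)

∀-freshOfTy : ∀ {L k m} → HasInf L → Ty k → Formula L k (suc m) → Formula L k m
∀-freshOfTy h t χ = ∀-ofTy t (or (namedByContext (hasInf⇒hasEq h)) χ)

universal-∀-ofTy : ∀ {L k m} (t : Ty k) {χ : Formula L k (suc m)} →
                   Universal χ → Universal (∀-ofTy t χ)
universal-∀-ofTy t u = all (or (universal-notTy t zero) u)

universal-∀-freshOfTy : ∀ {L k m} (h : HasInf L) (t : Ty k) {χ : Formula L k (suc m)} →
                        Universal χ → Universal (∀-freshOfTy h t χ)
universal-∀-freshOfTy {m = m} h t u =
  universal-∀-ofTy t (or (universal-⋁ (allFin m) λ v → eq (hasInf⇒hasEq h) zero (suc v)) u)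

Fresh : ∀ {n} {A : Set} → (Fin n → A) → A → Set
Fresh ρ a = ∀ j → ρ j ≢ a

Missing : ∀ {k} {𝔼 𝔻 : Model k} → SubmodelOf 𝔼 𝔻 → D 𝔻 → Set
Missing {𝔼 = 𝔼} sub d = ¬ Σ (D 𝔼) λ y → SubmodelOf.emb sub y ≡ d

record Rich {k} (L : Lang) (q : ℕ) {𝔼 𝔻 : Model k} (sub : SubmodelOf 𝔼 𝔻) : Set where
  open SubmodelOf sub
  field
    finitelyMissing : HasInf L → Finite (Missing sub)
    copies          : ∀ d → Missing sub d →
                      Σ (Fin q → D 𝔼) λ s →
                        Injective _≡_ _≡_ s × ∀ i → SameTy 𝔻 (emb (s i)) d

qrank : ∀ {L k n} → Formula L k n → ℕ
qrank (or φ ψ)     = qrank φ ⊔ qrank ψ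
qrank (and φ ψ)    = qrank φ ⊔ qrank ψ
qrank (ex φ)       = suc (qrank φ)
qrank (all φ)      = suc (qrank φ)
qrank (exInf _ φ)  = suc (qrank φ)
qrank (allInf _ φ) = suc (qrank φ)
qrank _            = 0

-- The translation

-- Read with its last N variables as x̄, rel φ says that φ holds in the submodel
-- generated by x̄ and the realisers of the types in S, which are meant to be
-- infinite: a quantified element is either named by a variable or an unnamed
-- realiser of a type in S, and the unnamed realisers of one type are all alike.
module Relativisation {L : Lang} {k : ℕ} (N : ℕ) (S : List (HasInf L × Ty k)) where
  rel : ∀ {n} → Formula L k n → Formula L k (n + N)
  rel tt           = tt
  rel ff           = ff
  rel (pos a x)    = pos a (x ↑ˡ N)
  rel (neg a x)    = neg a (x ↑ˡ N)
  rel (eq h x y)   = eq h (x ↑ˡ N) (y ↑ˡ N)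
  rel (neq h x y)  = neq h (x ↑ˡ N) (y ↑ˡ N)
  rel (or φ ψ)     = or (rel φ) (rel ψ)
  rel (and φ ψ)    = and (rel φ) (rel ψ)
  rel (ex ψ)       = or  (⋁ (allFin _) λ v → instantiate v (rel ψ))
                         (⋁ S λ (h , t) → ∀-freshOfTy h t (rel ψ))
  rel (all ψ)      = and (⋀ (allFin _) λ v → instantiate v (rel ψ))
                         (⋀ S λ (_ , t) → ∀-ofTy t (rel ψ))
  rel (exInf _ ψ)  = ⋁ S λ (h , t) → ∀-freshOfTy h t (rel ψ)
  rel (allInf _ ψ) = ⋀ S λ (h , t) → ∀-freshOfTy h t (rel ψ)

  universal-rel : ∀ {n} (φ : Formula L k n) → Universal (rel φ)
  universal-rel tt           = tt
  universal-rel ff           = ff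
  universal-rel (pos a x)    = pos a _
  universal-rel (neg a x)    = neg a _
  universal-rel (eq h x y)   = eq h _ _
  universal-rel (neq h x y)  = neq h _ _
  universal-rel (or φ ψ)     = or (universal-rel φ) (universal-rel ψ)
  universal-rel (and φ ψ)    = and (universal-rel φ) (universal-rel ψ)
  universal-rel (ex ψ)       =
    or  (universal-⋁ (allFin _) λ v → universal-rename (zero↦ v) (universal-rel ψ))
        (universal-⋁ S λ (h , t) → universal-∀-freshOfTy h t (universal-rel ψ))
  universal-rel (all ψ)      =
    and (universal-⋀ (allFin _) λ v → universal-rename (zero↦ v) (universal-rel ψ))
        (universal-⋀ S λ (_ , t) → universal-∀-ofTy t (universal-rel ψ))
  universal-rel (exInf _ ψ)  = universal-⋁ S λ (h , t) → universal-∀-freshOfTy h t (universal-rel ψ)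
  universal-rel (allInf _ ψ) = universal-⋀ S λ (h , t) → universal-∀-freshOfTy h t (universal-rel ψ)

subsets : {A : Set} → List A → List (List A)
subsets []       = [] ∷ []
subsets (x ∷ xs) = map (x ∷_) (subsets xs) ++ subsets xs

filter-∈-subsets : {A : Set} {P : A → Set} (P? : Decidable P) (xs : List A) →
                   filter P? xs ∈ subsets xs
filter-∈-subsets P? []       = here refl
filter-∈-subsets P? (x ∷ xs) with does (P? x)
... | true  = ∈-++⁺ˡ (∈-map⁺ (x ∷_) (filter-∈-subsets P? xs))
... | false = ∈-++⁺ʳ (map (x ∷_) (subsets xs)) (filter-∈-subsets P? xs)

-- Without ∞-quantifiers the infinite types need not be included in the
-- generated submodel, so the empty set of types is the only candidate.
candidates : (L : Lang) (k : ℕ) → List (List (HasInf L × Ty k))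
candidates M     k = [] ∷ []
candidates ME    k = [] ∷ []
candidates MEinf k = map (map (meinf ,_)) (subsets (allTys k))

someFinite : ∀ {L k} → List (HasInf L × Ty k) → Sentence L k
someFinite S = ⋁ S λ (h , t) → allInf h (notTy t zero)

-- Room for naming qrank φ realisers of every type.
bound : ∀ {L k} → Sentence L k → ℕ
bound {k = k} φ = length (allTys k) * qrank φ

clause : ∀ {L k} → Sentence L k → List (HasInf L × Ty k) → Sentence L k
clause φ S = or (someFinite S) (∀ⁿ (bound φ) (Relativisation.rel (bound φ) S φ))

infix 30 _⊗

_⊗ : ∀ {L k} → Sentence L k → Sentence L k
_⊗ {L} {k} φ = and (truthValue (holdsInEmpty φ)) (⋀ (candidates L k) (clause φ))

universal-⊗ : ∀ {L k} (φ : Sentence L k) → Universal (φ ⊗)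
universal-⊗ {L} {k} φ = and (universal-truthValue (holdsInEmpty φ))
  (universal-⋀ (candidates L k) λ S →
    or (universal-⋁ S λ (h , t) → allInf h (universal-notTy t zero))
       (universal-∀ⁿ (bound φ) (Relativisation.universal-rel (bound φ) S φ)))

module Classical (lem : ExcludedMiddle 0ℓ) where

  dne : DoubleNegationElimination 0ℓ
  dne = em⇒dne lem

  ¬finite⇒∉ : {A : Set} {P : A → Set} → ¬ Finite P → (xs : List A) → Σ A λ a → P a × a ∉ xs
  ¬finite⇒∉ ¬fin xs = dne λ ∄ → ¬fin (xs , λ a p → dne λ a∉xs → ∄ (a , p , a∉xs))

  preimage : {A B : Set} → (A → B) → List B → List A
  preimage e [] = []
  preimage {A} e (b ∷ bs) with lem {Σ A λ a → e a ≡ b}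
  ... | yes (a , _) = a ∷ preimage e bs
  ... | no  _       = preimage e bs

  ∈-preimage : {A B : Set} {e : A → B} → Injective _≡_ _≡_ e →
               ∀ {a} bs → e a ∈ bs → a ∈ preimage e bs
  ∈-preimage {A} {e = e} e-inj {a} (b ∷ bs) ea∈ with lem {Σ A λ a → e a ≡ b} | ea∈
  ... | yes (a' , ea'≡b) | here ea≡b   = here (e-inj (trans ea≡b (sym ea'≡b)))
  ... | yes _            | there ea∈bs = there (∈-preimage e-inj bs ea∈bs)
  ... | no ∄             | here ea≡b   = ⊥-elim (∄ (a , ea≡b))
  ... | no _             | there ea∈bs = ∈-preimage e-inj bs ea∈bs

  finite-preimage : {A B : Set} {e : A → B} → Injective _≡_ _≡_ e →
                    {P : B → Set} {Q : A → Set} →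
                    (∀ a → Q a → P (e a)) → Finite P → Finite Q
  finite-preimage {e = e} e-inj Q⊆P∘e (bs , covers) =
    preimage e bs , λ a q → ∈-preimage e-inj bs (covers (e a) (Q⊆P∘e a q))

  module _ {k : ℕ} {𝔻 𝔼 : Model k} (sub : SubmodelOf 𝔼 𝔻) where
    open SubmodelOf sub

    universal-reflect : ∀ {L n} {φ : Formula L k n} → Universal φ →
                        ∀ {ρ τ} → τ ≗ emb ∘ ρ → Sat 𝔻 τ φ → Sat 𝔼 ρ φ
    universal-reflect tt           τ≗ s = s
    universal-reflect ff           τ≗ s = s
    universal-reflect (pos a x)    τ≗ = from (V-along sub a x τ≗)
    universal-reflect (neg a x)    τ≗ = from (¬-cong-⇔ (V-along sub a x τ≗))
    universal-reflect (eq _ x y)   τ≗ = from (≡-along sub x y τ≗)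
    universal-reflect (neq _ x y)  τ≗ = from (¬-cong-⇔ (≡-along sub x y τ≗))
    universal-reflect (or u v)     τ≗ (inj₁ s) = inj₁ (universal-reflect u τ≗ s)
    universal-reflect (or u v)     τ≗ (inj₂ s) = inj₂ (universal-reflect v τ≗ s)
    universal-reflect (and u v)    τ≗ (s , t) = universal-reflect u τ≗ s , universal-reflect v τ≗ t
    universal-reflect (all u)      τ≗ s d = universal-reflect u (extend-∘ emb τ≗ d) (s (emb d))
    universal-reflect (allInf _ u) τ≗ s =
      finite-preimage injective
        (λ d ¬s𝔼 s𝔻 → ¬s𝔼 (universal-reflect u (extend-∘ emb τ≗ d) s𝔻)) s

  universal⇒preserved : ∀ {L k} {φ : Sentence L k} → Universal φ → PreservedUnderSubmodels φ
  universal⇒preserved u 𝔻 𝔼 sub = universal-reflect sub u λ ()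

  module _ {k : ℕ} (𝔻 : Model k) {d d' : D 𝔻} (d≈d' : SameTy 𝔻 d d') where
    private
      π : D 𝔻 → D 𝔻
      π x with lem {x ≡ d} | lem {x ≡ d'}
      ... | yes _ | _     = d'
      ... | no _  | yes _ = d
      ... | no _  | no _  = x

      π-d : π d ≡ d'
      π-d with lem {d ≡ d} | lem {d ≡ d'}
      ... | yes _  | _ = refl
      ... | no d≢d | _ = ⊥-elim (d≢d refl)

      π-d' : π d' ≡ d
      π-d' with lem {d' ≡ d} | lem {d' ≡ d'}
      ... | yes d'≡d | _        = d'≡d
      ... | no _     | yes _    = refl
      ... | no _     | no d'≢d' = ⊥-elim (d'≢d' refl)

      π-fixes : ∀ x → x ≢ d → x ≢ d' → π x ≡ x
      π-fixes x x≢d x≢d' with lem {x ≡ d} | lem {x ≡ d'}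
      ... | yes x≡d | _        = ⊥-elim (x≢d x≡d)
      ... | no _    | yes x≡d' = ⊥-elim (x≢d' x≡d')
      ... | no _    | no _     = refl

      π-involutive : ∀ x → π (π x) ≡ x
      π-involutive x with lem {x ≡ d} | lem {x ≡ d'}
      ... | yes x≡d | _        = trans π-d' (sym x≡d)
      ... | no _    | yes x≡d' = trans π-d (sym x≡d')
      ... | no x≢d  | no x≢d'  = π-fixes x x≢d x≢d'

      π-respects : ∀ a x → V 𝔻 a x ⇔ V 𝔻 a (π x)
      π-respects a x with lem {x ≡ d} | lem {x ≡ d'}
      ... | yes refl | _        = d≈d' a
      ... | no _     | yes refl = ⇔-sym (d≈d' a)
      ... | no _     | no _     = ⇔-id _

      transposition : Isomorphism 𝔻 𝔻
      transposition = record
        { bijection = mk↔ₛ′ π π π-involutive π-involutive ; respects = π-respects }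

    sat-swap : ∀ {L n} (ψ : Formula L k (suc n)) {ρ : Fin n → D 𝔻} →
               Fresh ρ d → Fresh ρ d' → Sat 𝔻 (extend d ρ) ψ → Sat 𝔻 (extend d' ρ) ψ
    sat-swap ψ {ρ} d∉ρ d'∉ρ = to (sat-iso transposition ψ moved)
      where
      moved : extend d' ρ ≗ π ∘ extend d ρ
      moved zero    = sym π-d
      moved (suc j) = sym (π-fixes (ρ j) (d∉ρ j) (d'∉ρ j))

  -- Back-and-forth transfer to rich submodels

  injective-escapes : {A : Set} {n q : ℕ} → n < q → (s : Fin q → A) → Injective _≡_ _≡_ s →
                      (ρ : Fin n → A) → Σ (Fin q) λ i → Fresh ρ (s i)
  injective-escapes n<q s s-inj ρ = dne λ ∄ → pigeonhole-contradiction λ i →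
    dne λ ∄j → ∄ (i , λ j ρj≡si → ∄j (j , ρj≡si))
    where
    pigeonhole-contradiction : (∀ i → Σ (Fin _) λ j → ρ j ≡ s i) → ⊥
    pigeonhole-contradiction hit with pigeonhole n<q (proj₁ ∘ hit)
    ... | i , i' , i<i' , same = <⇒≢ i<i'
          (s-inj (trans (sym (proj₂ (hit i))) (trans (cong ρ same) (proj₂ (hit i')))))

  module _ {L : Lang} {k q : ℕ} {𝔼 𝔻 : Model k} {sub : SubmodelOf 𝔼 𝔻} (rich : Rich L q sub) where
    open SubmodelOf sub
    open Rich rich

    private
      fresh-copy : ∀ {n} → n < q → {ρ : Fin n → D 𝔼} {τ : Fin n → D 𝔻} → τ ≗ emb ∘ ρ →
                   ∀ d → Missing sub d →
                   Σ (D 𝔼) λ y → SameTy 𝔻 (emb y) d × Fresh τ (emb y) × Fresh τ d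
      fresh-copy n<q {ρ} τ≗ d d∉ with copies d d∉
      ... | s , s-inj , s≈d with injective-escapes n<q s s-inj ρ
      ... | i , si∉ρ = s i , s≈d i
                     , (λ j τj≡ → si∉ρ j (injective (trans (sym (τ≗ j)) τj≡)))
                     , (λ j τj≡d → d∉ (ρ j , trans (sym (τ≗ j)) τj≡d))

      finite-⇔-rich : HasInf L → {P : D 𝔼 → Set} {Q : D 𝔻 → Set} →
                       (∀ y → P y ⇔ Q (emb y)) → Finite P ⇔ Finite Q
      finite-⇔-rich hi {P} {Q} P⇔Q∘emb = mk⇔ covered
        (finite-preimage injective λ y → to (P⇔Q∘emb y))
        where
        covered : Finite P → Finite Q
        covered (ys , ys-covers) with finitelyMissing hi
        ... | ms , ms-covers = map emb ys ++ ms , cover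
          where
          cover : ∀ d → Q d → d ∈ map emb ys ++ ms
          cover d Qd with lem {Σ (D 𝔼) λ y → emb y ≡ d}
          ... | yes (y , refl) = ∈-++⁺ˡ (∈-map⁺ emb (ys-covers y (from (P⇔Q∘emb y) Qd)))
          ... | no d∉          = ∈-++⁺ʳ (map emb ys) (ms-covers d d∉)

      rank-⊔ˡ : ∀ n {a b} → n + (a ⊔ b) ≤ q → n + a ≤ q
      rank-⊔ˡ n {a} {b} = ≤-trans (+-monoʳ-≤ n (m≤m⊔n a b))

      rank-⊔ʳ : ∀ n {a b} → n + (a ⊔ b) ≤ q → n + b ≤ q
      rank-⊔ʳ n {a} {b} = ≤-trans (+-monoʳ-≤ n (m≤n⊔m a b))

      rank-suc : ∀ {n a} → n + suc a ≤ q → suc n + a ≤ q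
      rank-suc {n} {a} = subst (_≤ q) (+-suc n a)

      rank-< : ∀ {n a} → n + suc a ≤ q → n < q
      rank-< {n} {a} h = ≤-trans (m≤m+n (suc n) a) (rank-suc h)

    -- A missing element can be traded for one of its q copies that is not yet
    -- named, which is possible as long as fewer than q variables are in use.
    sat-rich : ∀ {n} (φ : Formula L k n) → n + qrank φ ≤ q →
               ∀ {ρ τ} → τ ≗ emb ∘ ρ → Sat 𝔼 ρ φ ⇔ Sat 𝔻 τ φ
    sat-rich tt           _ τ≗ = ⇔-id _
    sat-rich ff           _ τ≗ = ⇔-id _
    sat-rich (pos a x)    _ τ≗ = V-along sub a x τ≗
    sat-rich (neg a x)    _ τ≗ = ¬-cong-⇔ (V-along sub a x τ≗)
    sat-rich (eq _ x y)   _ τ≗ = ≡-along sub x y τ≗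
    sat-rich (neq _ x y)  _ τ≗ = ¬-cong-⇔ (≡-along sub x y τ≗)
    sat-rich {n} (or φ ψ)  r τ≗ = sat-rich φ (rank-⊔ˡ n r) τ≗ ⊎-⇔ sat-rich ψ (rank-⊔ʳ n r) τ≗
    sat-rich {n} (and φ ψ) r τ≗ = sat-rich φ (rank-⊔ˡ n r) τ≗ ×-⇔ sat-rich ψ (rank-⊔ʳ n r) τ≗
    sat-rich (ex φ)       r {ρ} {τ} τ≗ = mk⇔ (λ (y , s) → emb y , to (IH y) s) witness
      where
      IH : ∀ y → Sat 𝔼 (extend y ρ) φ ⇔ Sat 𝔻 (extend (emb y) τ) φ
      IH y = sat-rich φ (rank-suc r) (extend-∘ emb τ≗ y)
      witness : Sat 𝔻 τ (ex φ) → Sat 𝔼 ρ (ex φ)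
      witness (d , s) with lem {Σ (D 𝔼) λ y → emb y ≡ d}
      ... | yes (y , refl) = y , from (IH y) s
      ... | no d∉ with fresh-copy (rank-< r) τ≗ d d∉
      ... | y , y≈d , y∉τ , d∉τ = y , from (IH y) (sat-swap 𝔻 (⇔-sym ∘ y≈d) φ d∉τ y∉τ s)
    sat-rich (all φ)      r {ρ} {τ} τ≗ = mk⇔ everywhere (λ t y → from (IH y) (t (emb y)))
      where
      IH : ∀ y → Sat 𝔼 (extend y ρ) φ ⇔ Sat 𝔻 (extend (emb y) τ) φ
      IH y = sat-rich φ (rank-suc r) (extend-∘ emb τ≗ y)
      everywhere : Sat 𝔼 ρ (all φ) → Sat 𝔻 τ (all φ)
      everywhere t d with lem {Σ (D 𝔼) λ y → emb y ≡ d}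
      ... | yes (y , refl) = to (IH y) (t y)
      ... | no d∉ with fresh-copy (rank-< r) τ≗ d d∉
      ... | y , y≈d , y∉τ , d∉τ = sat-swap 𝔻 y≈d φ y∉τ d∉τ (to (IH y) (t y))
    sat-rich (exInf hi φ)  r τ≗ = ¬-cong-⇔ (finite-⇔-rich hi λ y →
      sat-rich φ (rank-suc r) (extend-∘ emb τ≗ y))
    sat-rich (allInf hi φ) r τ≗ = finite-⇔-rich hi λ y →
      ¬-cong-⇔ (sat-rich φ (rank-suc r) (extend-∘ emb τ≗ y))

  module _ {L : Lang} {k : ℕ} (𝔻 : Model k) where
    sat-litFalsifying : ∀ {m} {ρ : Fin m → D 𝔻} b a (x : Fin m) →
                        Sat {L} 𝔻 ρ (litFalsifying b a x) ⇔ (¬ Lit b (V 𝔻 a (ρ x)))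
    sat-litFalsifying true  a x = ⇔-id _
    sat-litFalsifying false a x = mk⇔ (λ v ¬v → ¬v v) dne

    sat-notTy : ∀ {m} {ρ : Fin m → D 𝔻} (t : Ty k) (x : Fin m) →
                Sat {L} 𝔻 ρ (notTy t x) ⇔ (¬ HasTy 𝔻 t (ρ x))
    sat-notTy t x =
      mk⇔ (λ (a , ¬lit) t[ρx] → ¬lit (t[ρx] a))
          (λ ¬t[ρx] → dne λ ∄ → ¬t[ρx] λ a → dne λ ¬lit → ∄ (a , ¬lit))
      ⇔-∘ (Σ-cong-⇔ (λ a → sat-litFalsifying (lookup t a) a x)
      ⇔-∘ sat-⋁-allFin 𝔻 (λ a → litFalsifying (lookup t a) a x))

    sat-∀-ofTy : ∀ {m} {τ : Fin m → D 𝔻} (t : Ty k) (χ : Formula L k (suc m)) →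
                 Sat 𝔻 τ (∀-ofTy t χ) ⇔ (∀ d → HasTy 𝔻 t d → Sat 𝔻 (extend d τ) χ)
    sat-∀-ofTy {τ = τ} t χ = Π-cong-⇔ λ d → mk⇔
      (λ s t[d] → [ (λ ¬t[d] → ⊥-elim (to (sat-notTy t zero) ¬t[d] t[d])) , id ] s)
      (by-type d)
      where
      by-type : ∀ d → (HasTy 𝔻 t d → Sat 𝔻 (extend d τ) χ) →
                Sat 𝔻 (extend d τ) (or (notTy t zero) χ)
      by-type d s with lem {HasTy 𝔻 t d}
      ... | yes t[d] = inj₂ (s t[d])
      ... | no ¬t[d] = inj₁ (from (sat-notTy t zero) ¬t[d])

    sat-∀-freshOfTy : ∀ {m} {τ : Fin m → D 𝔻} (h : HasInf L) (t : Ty k)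
                      (χ : Formula L k (suc m)) →
                      Sat 𝔻 τ (∀-freshOfTy h t χ) ⇔
                      (∀ d → HasTy 𝔻 t d → Fresh τ d → Sat 𝔻 (extend d τ) χ)
    sat-∀-freshOfTy {m} {τ} h t χ =
      Π-cong-⇔ (λ d → Π-cong-⇔ λ _ →
        named-or ⇔-∘ (sat-⋁-allFin 𝔻 {ρ = extend d τ} (λ v → eq (hasInf⇒hasEq h) zero (suc v))
                      ⊎-⇔ ⇔-id _))
      ⇔-∘ sat-∀-ofTy t (or (namedByContext (hasInf⇒hasEq h)) χ)
      where
      named-or : ∀ {d} {X : Set} → ((Σ (Fin m) λ v → d ≡ τ v) ⊎ X) ⇔ (Fresh τ d → X)
      named-or {d} = mk⇔
        [ (λ (v , d≡τv) d∉τ → ⊥-elim (d∉τ v (sym d≡τv))) , (λ x _ → x) ] by-freshness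
        where
        by-freshness : ∀ {X} → (Fresh τ d → X) → (Σ (Fin m) λ v → d ≡ τ v) ⊎ X
        by-freshness x with lem {Σ (Fin m) λ v → d ≡ τ v}
        ... | yes named = inj₁ named
        ... | no ∄      = inj₂ (x λ v τv≡d → ∄ (v , sym τv≡d))

  module Restriction {k : ℕ} (𝔻 : Model k) (P : D 𝔻 → Set) where
    -- Membership is stored as `True (lem {P d})`, which is proof-irrelevant, so
    -- points of the restriction are determined by their underlying element.
    restriction : Model k
    restriction = record { D = Σ (D 𝔻) λ d → True (lem {P d}) ; V = λ a → V 𝔻 a ∘ proj₁ }

    restriction-submodel : SubmodelOf restriction 𝔻
    restriction-submodel = record
      { emb = proj₁ ; injective = proj₁-injective ; respects = λ _ _ → ⇔-id _ }
      where
      proj₁-injective : Injective _≡_ _≡_ (proj₁ {B = λ d → True (lem {P d})})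
      proj₁-injective {d , p} {.d , p'} refl = cong (d ,_) (T-irrelevant p p')

    ⟨_,_⟩ : (d : D 𝔻) → P d → D restriction
    ⟨ d , p ⟩ = d , fromWitness p

    member : (y : D restriction) → P (proj₁ y)
    member (_ , p) = toWitness p

  module RelativisationSemantics {L : Lang} {k N : ℕ} (𝔻 : Model k) (xs : Fin N → D 𝔻)
           (S : List (HasInf L × Ty k))
           (S-infinite : ∀ {p} → p ∈ S → ¬ Finite (HasTy 𝔻 (proj₂ p))) where
    open Relativisation N S

    Generated : D 𝔻 → Set
    Generated d = (Σ (Fin N) λ j → xs j ≡ d)
                ⊎ (Σ (HasInf L × Ty k) λ p → p ∈ S × HasTy 𝔻 (proj₂ p) d)

    open Restriction 𝔻 Generated public
      renaming (restriction to 𝔼; restriction-submodel to 𝔼⊆𝔻)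

    typed : ∀ {p} → p ∈ S → ∀ {d} → HasTy 𝔻 (proj₂ p) d → D 𝔼
    typed {p} p∈S {d} t[d] = ⟨ d , inj₂ (p , p∈S , t[d]) ⟩

    module Context {n : ℕ} (ρ : Fin n → D 𝔼) (τ : Fin (n + N) → D 𝔻)
                   (τ≗ : τ ≗ (proj₁ ∘ ρ) ⧺ xs) where
      τ∘↑ˡ : τ ∘ (_↑ˡ N) ≗ proj₁ ∘ ρ
      τ∘↑ˡ x = trans (τ≗ (x ↑ˡ N)) (lookup-++ˡ (proj₁ ∘ ρ) xs x)

      τ∘↑ʳ : ∀ j → τ (n ↑ʳ j) ≡ xs j
      τ∘↑ʳ j = trans (τ≗ (n ↑ʳ j)) (lookup-++ʳ (proj₁ ∘ ρ) xs j)

      extend-≗ : ∀ y → extend (proj₁ y) τ ≗ (proj₁ ∘ extend y ρ) ⧺ xs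
      extend-≗ y zero    = refl
      extend-≗ y (suc v) with splitAt n v | τ≗ v
      ... | inj₁ _ | τv≡ = τv≡
      ... | inj₂ _ | τv≡ = τv≡

      named : Fin (n + N) → D 𝔼
      named v = ⟨ τ v , generated v ⟩
        where
        generated : ∀ v → Generated (τ v)
        generated v with splitAt n v | τ≗ v
        ... | inj₁ i | τv≡ρi = subst Generated (sym τv≡ρi) (member (ρ i))
        ... | inj₂ j | τv≡xj = inj₁ (j , sym τv≡xj)

      Fresh-ρ : ∀ {y} → Fresh τ (proj₁ y) → Fresh ρ y
      Fresh-ρ y∉τ j ρj≡y = y∉τ (j ↑ˡ N) (trans (τ∘↑ˡ j) (cong proj₁ ρj≡y))

      named-or-typed : (y : D 𝔼) →
                       (Σ (Fin (n + N)) λ v → named v ≡ y)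
                       ⊎ (Fresh τ (proj₁ y) ×
                          Σ (HasInf L × Ty k) λ p → p ∈ S × HasTy 𝔻 (proj₂ p) (proj₁ y))
      named-or-typed y with lem {Σ (Fin (n + N)) λ v → τ v ≡ proj₁ y} | member y
      ... | yes (v , τv≡y) | _                   = inj₁ (v , SubmodelOf.injective 𝔼⊆𝔻 τv≡y)
      ... | no ∄           | inj₁ (j , xj≡y)     = ⊥-elim (∄ (n ↑ʳ j , trans (τ∘↑ʳ j) xj≡y))
      ... | no ∄           | inj₂ of-type        = inj₂ ((λ v τv≡y → ∄ (v , τv≡y)) , of-type)

      unnamed-of-type : ∀ {p} → p ∈ S → (ds : List (D 𝔻)) →
                        Σ (D 𝔻) λ d → HasTy 𝔻 (proj₂ p) d × d ∉ ds × Fresh τ d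
      unnamed-of-type p∈S ds with ¬finite⇒∉ (S-infinite p∈S) (ds ++ tabulate τ)
      ... | d , t[d] , d∉ = d , t[d] , d∉ ∘ ∈-++⁺ˡ , λ v τv≡d →
                            d∉ (∈-++⁺ʳ ds (subst (_∈ tabulate τ) τv≡d (∈-tabulate⁺ v)))

      module _ (ψ : Formula L k (suc n))
               (IH : ∀ y → Sat 𝔼 (extend y ρ) ψ ⇔ Sat 𝔻 (extend (proj₁ y) τ) (rel ψ)) where
        at-named : ∀ v → Sat 𝔼 (extend (named v) ρ) ψ ⇔ Sat 𝔻 τ (instantiate v (rel ψ))
        at-named v = ⇔-sym (sat-instantiate 𝔻 v (rel ψ)) ⇔-∘ IH (named v)

        -- All fresh elements of one type in 𝔼 are interchangeable, so one
        -- fresh witness of type t yields all of them.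
        ∀-freshOfTy-intro : ∀ {p} → p ∈ S → (y : D 𝔼) → HasTy 𝔻 (proj₂ p) (proj₁ y) →
                            Fresh τ (proj₁ y) → Sat 𝔼 (extend y ρ) ψ →
                            Sat 𝔻 τ (∀-freshOfTy (proj₁ p) (proj₂ p) (rel ψ))
        ∀-freshOfTy-intro {h , t} p∈S y t[y] y∉τ s = from (sat-∀-freshOfTy 𝔻 h t (rel ψ))
          λ d t[d] d∉τ → to (IH (typed p∈S t[d]))
            (sat-swap 𝔼 (hasTy⇒sameTy 𝔻 t t[y] t[d]) ψ (Fresh-ρ y∉τ) (Fresh-ρ d∉τ) s)

        ∀-freshOfTy-elim : ∀ ((h , t) : HasInf L × Ty k) → Sat 𝔻 τ (∀-freshOfTy h t (rel ψ)) →
                           (y : D 𝔼) → HasTy 𝔻 t (proj₁ y) → Fresh τ (proj₁ y) →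
                           Sat 𝔼 (extend y ρ) ψ
        ∀-freshOfTy-elim (h , t) g y t[y] y∉τ =
          from (IH y) (to (sat-∀-freshOfTy 𝔻 h t (rel ψ)) g (proj₁ y) t[y] y∉τ)

        sat-rel-ex : Sat 𝔼 ρ (ex ψ) ⇔ Sat 𝔻 τ (rel (ex ψ))
        sat-rel-ex = mk⇔ witness-to witness-from
          where
          witness-to : Sat 𝔼 ρ (ex ψ) → Sat 𝔻 τ (rel (ex ψ))
          witness-to (y , s) with named-or-typed y
          ... | inj₁ (v , refl) = inj₁ (from (sat-⋁-allFin 𝔻 _) (v , to (at-named v) s))
          ... | inj₂ (y∉τ , p , p∈S , t[y]) =
            inj₂ (from (sat-⋁ 𝔻 S _) (p , p∈S , ∀-freshOfTy-intro p∈S y t[y] y∉τ s))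

          witness-from : Sat 𝔻 τ (rel (ex ψ)) → Sat 𝔼 ρ (ex ψ)
          witness-from (inj₁ s) with to (sat-⋁-allFin 𝔻 _) s
          ... | v , s[v] = named v , from (at-named v) s[v]
          witness-from (inj₂ s) with to (sat-⋁ 𝔻 S _) s
          ... | p , p∈S , g with unnamed-of-type p∈S []
          ... | d , t[d] , _ , d∉τ = typed p∈S t[d] , ∀-freshOfTy-elim p g (typed p∈S t[d]) t[d] d∉τ

        sat-rel-all : Sat 𝔼 ρ (all ψ) ⇔ Sat 𝔻 τ (rel (all ψ))
        sat-rel-all = mk⇔
          (λ s → from (sat-⋀-allFin 𝔻 _) (λ v → to (at-named v) (s (named v)))
               , from (sat-⋀ 𝔻 S _) λ (_ , t) p∈S → from (sat-∀-ofTy 𝔻 t (rel ψ))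
                   λ d t[d] → to (IH (typed p∈S t[d])) (s (typed p∈S t[d])))
          everywhere
          where
          everywhere : Sat 𝔻 τ (rel (all ψ)) → Sat 𝔼 ρ (all ψ)
          everywhere (s-named , s-typed) y with named-or-typed y
          ... | inj₁ (v , refl) = from (at-named v) (to (sat-⋀-allFin 𝔻 _) s-named v)
          ... | inj₂ (_ , p , p∈S , t[y]) =
            from (IH y) (to (sat-∀-ofTy 𝔻 (proj₂ p) (rel ψ))
                            (to (sat-⋀ 𝔻 S _) s-typed p p∈S) (proj₁ y) t[y])

        sat-rel-exInf : ∀ h → Sat 𝔼 ρ (exInf h ψ) ⇔ Sat 𝔻 τ (rel (exInf h ψ))
        sat-rel-exInf h = mk⇔ many-to many-from
          where
          many-to : Sat 𝔼 ρ (exInf h ψ) → Sat 𝔻 τ (rel (exInf h ψ))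
          many-to ¬fin with ¬finite⇒∉ ¬fin (tabulate named)
          ... | y , s , y∉named with named-or-typed y
          ... | inj₁ (v , refl) = ⊥-elim (y∉named (∈-tabulate⁺ v))
          ... | inj₂ (y∉τ , p , p∈S , t[y]) =
            from (sat-⋁ 𝔻 S _) (p , p∈S , ∀-freshOfTy-intro p∈S y t[y] y∉τ s)

          many-from : Sat 𝔻 τ (rel (exInf h ψ)) → Sat 𝔼 ρ (exInf h ψ)
          many-from s (ys , covers) with to (sat-⋁ 𝔻 S _) s
          ... | p , p∈S , g with unnamed-of-type p∈S (map proj₁ ys)
          ... | d , t[d] , d∉ys , d∉τ =
            d∉ys (∈-map⁺ proj₁ (covers (typed p∈S t[d])
                                  (∀-freshOfTy-elim p g (typed p∈S t[d]) t[d] d∉τ)))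

        sat-rel-allInf : ∀ h → Sat 𝔼 ρ (allInf h ψ) ⇔ Sat 𝔻 τ (rel (allInf h ψ))
        sat-rel-allInf h = mk⇔ cofinite-to cofinite-from
          where
          cofinite-to : Sat 𝔼 ρ (allInf h ψ) → Sat 𝔻 τ (rel (allInf h ψ))
          cofinite-to (ys , covers) = from (sat-⋀ 𝔻 S _) λ p p∈S →
            let (d , t[d] , d∉ys , d∉τ) = unnamed-of-type p∈S (map proj₁ ys) in
            ∀-freshOfTy-intro p∈S (typed p∈S t[d]) t[d] d∉τ
              (dne λ ¬s → d∉ys (∈-map⁺ proj₁ (covers (typed p∈S t[d]) ¬s)))

          cofinite-from : Sat 𝔻 τ (rel (allInf h ψ)) → Sat 𝔼 ρ (allInf h ψ)
          cofinite-from g = tabulate named , covers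
            where
            covers : ∀ y → ¬ Sat 𝔼 (extend y ρ) ψ → y ∈ tabulate named
            covers y ¬s with named-or-typed y
            ... | inj₁ (v , refl) = ∈-tabulate⁺ v
            ... | inj₂ (y∉τ , p , p∈S , t[y]) =
              ⊥-elim (¬s (∀-freshOfTy-elim p (to (sat-⋀ 𝔻 S _) g p p∈S) y t[y] y∉τ))

    sat-rel : ∀ {n} (φ : Formula L k n) {ρ : Fin n → D 𝔼} {τ : Fin (n + N) → D 𝔻} →
              τ ≗ (proj₁ ∘ ρ) ⧺ xs → Sat 𝔼 ρ φ ⇔ Sat 𝔻 τ (rel φ)
    sat-rel tt           τ≗ = ⇔-id _
    sat-rel ff           τ≗ = ⇔-id _
    sat-rel (pos a x)    {ρ} {τ} τ≗ = V-along 𝔼⊆𝔻 a x {ρ} (Context.τ∘↑ˡ ρ τ τ≗)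
    sat-rel (neg a x)    {ρ} {τ} τ≗ = ¬-cong-⇔ (V-along 𝔼⊆𝔻 a x {ρ} (Context.τ∘↑ˡ ρ τ τ≗))
    sat-rel (eq _ x y)   {ρ} {τ} τ≗ = ≡-along 𝔼⊆𝔻 x y (Context.τ∘↑ˡ ρ τ τ≗)
    sat-rel (neq _ x y)  {ρ} {τ} τ≗ = ¬-cong-⇔ (≡-along 𝔼⊆𝔻 x y (Context.τ∘↑ˡ ρ τ τ≗))
    sat-rel (or φ ψ)     τ≗ = sat-rel φ τ≗ ⊎-⇔ sat-rel ψ τ≗
    sat-rel (and φ ψ)    τ≗ = sat-rel φ τ≗ ×-⇔ sat-rel ψ τ≗
    sat-rel (ex ψ)       {ρ} {τ} τ≗ = sat-rel-ex ψ (λ y → sat-rel ψ (extend-≗ y))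
      where open Context ρ τ τ≗
    sat-rel (all ψ)      {ρ} {τ} τ≗ = sat-rel-all ψ (λ y → sat-rel ψ (extend-≗ y))
      where open Context ρ τ τ≗
    sat-rel (exInf h ψ)  {ρ} {τ} τ≗ = sat-rel-exInf ψ (λ y → sat-rel ψ (extend-≗ y)) h
      where open Context ρ τ τ≗
    sat-rel (allInf h ψ) {ρ} {τ} τ≗ = sat-rel-allInf ψ (λ y → sat-rel ψ (extend-≗ y)) h
      where open Context ρ τ τ≗

  sat-someFinite : ∀ {L k} (𝔻 : Model k) (S : List (HasInf L × Ty k)) →
                   𝔻 ⊨ someFinite S ⇔
                   (Σ (HasInf L × Ty k) λ p → p ∈ S × Finite (HasTy 𝔻 (proj₂ p)))
  sat-someFinite 𝔻 S =
    Σ-cong-⇔ (λ (_ , t) → ⇔-id _ ×-⇔ finite-cong λ d →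
      mk⇔ dne (λ t[d] ¬t[d] → ¬t[d] t[d]) ⇔-∘ ¬-cong-⇔ (sat-notTy 𝔻 t zero))
    ⇔-∘ sat-⋁ 𝔻 S _

  extend-injective : ∀ {n} {A : Set} {s : Fin n → A} {d : A} →
                     Injective _≡_ _≡_ s → Fresh s d → Injective _≡_ _≡_ (extend d s)
  extend-injective s-inj d∉s {zero}  {zero}  _     = refl
  extend-injective s-inj d∉s {zero}  {suc j} d≡sj  = ⊥-elim (d∉s j (sym d≡sj))
  extend-injective s-inj d∉s {suc i} {zero}  si≡d  = ⊥-elim (d∉s i si≡d)
  extend-injective s-inj d∉s {suc i} {suc j} si≡sj = cong suc (s-inj si≡sj)

  -- The padding element d₀ is only used in the first alternative, when P has
  -- fewer than q elements.
  exhaust-or-inject : {A : Set} (P : A → Set) → A → (q : ℕ) →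
                      Σ (Fin q → A) λ s → (∀ d → P d → Σ (Fin q) λ j → s j ≡ d)
                                        ⊎ (Injective _≡_ _≡_ s × ∀ j → P (s j))
  exhaust-or-inject P d₀ zero = (λ ()) , inj₂ ((λ { {()} }) , λ ())
  exhaust-or-inject {A} P d₀ (suc q) with exhaust-or-inject P d₀ q
  ... | s , inj₁ exhausts =
    extend d₀ s , inj₁ λ d p → let (j , sj≡d) = exhausts d p in suc j , sj≡d
  ... | s , inj₂ (s-inj , s∈P) with lem {Σ A λ d → P d × Fresh s d}
  ...   | yes (d , p , d∉s) =
    extend d s , inj₂ (extend-injective s-inj d∉s , λ { zero → p ; (suc j) → s∈P j })
  ...   | no ∄ = extend d₀ s , inj₁ λ d p →
            let (j , sj≡d) = dne λ ∄j → ∄ (d , p , λ j sj≡d → ∄j (j , sj≡d)) in suc j , sj≡d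

  typeOf : ∀ {k} (𝔻 : Model k) → D 𝔻 → Ty k
  typeOf 𝔻 d = Vec.tabulate λ a → isYes (lem {V 𝔻 a d})

  hasTy-typeOf : ∀ {k} (𝔻 : Model k) d → HasTy 𝔻 (typeOf 𝔻 d) d
  hasTy-typeOf 𝔻 d a rewrite lookup∘tabulate (λ a → isYes (lem {V 𝔻 a d})) a with lem {V 𝔻 a d}
  ... | yes Vd  = Vd
  ... | no  ¬Vd = ¬Vd

  module _ {k : ℕ} (𝔻 : Model k) where
    private
      infinite? : Decidable λ t → ¬ Finite (HasTy 𝔻 t)
      infinite? t = lem

    infiniteTys : List (Ty k)
    infiniteTys = filter infinite? (allTys k)

    infiniteCandidate : (L : Lang) → List (HasInf L × Ty k)
    infiniteCandidate M     = []
    infiniteCandidate ME    = []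
    infiniteCandidate MEinf = map (meinf ,_) infiniteTys

    infiniteCandidate-∈ : ∀ L → infiniteCandidate L ∈ candidates L k
    infiniteCandidate-∈ M     = here refl
    infiniteCandidate-∈ ME    = here refl
    infiniteCandidate-∈ MEinf = ∈-map⁺ (map (meinf ,_)) (filter-∈-subsets infinite? (allTys k))

    infiniteCandidate-infinite : ∀ {L p} → p ∈ infiniteCandidate L → ¬ Finite (HasTy 𝔻 (proj₂ p))
    infiniteCandidate-infinite {MEinf} p∈ with ∈-map⁻ (meinf ,_) p∈
    ... | t , t∈ , refl = proj₂ (∈-filter⁻ infinite? {xs = allTys k} t∈)

    infiniteCandidate-complete : ∀ {L} → HasInf L → ∀ {t} → ¬ Finite (HasTy 𝔻 t) →
                                 Σ (HasInf L) λ h → (h , t) ∈ infiniteCandidate L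
    infiniteCandidate-complete meinf {t} ¬fin =
      meinf , ∈-map⁺ (meinf ,_) (∈-filter⁺ infinite? (∈-allTys t) ¬fin)

    infiniteCandidate-¬someFinite : ∀ L → ¬ 𝔻 ⊨ someFinite (infiniteCandidate L)
    infiniteCandidate-¬someFinite L some-finite =
      let (_ , p∈S , p-finite) = to (sat-someFinite 𝔻 (infiniteCandidate L)) some-finite
      in infiniteCandidate-infinite p∈S p-finite

  module Witnesses {L : Lang} {k : ℕ} (𝔻 : Model k) (d₀ : D 𝔻) (q : ℕ) where
    picks : Ty k → Fin q → D 𝔻
    picks t = proj₁ (exhaust-or-inject (HasTy 𝔻 t) d₀ q)

    pickAt : Fin (length (allTys k)) → Fin q → D 𝔻
    pickAt i = picks (List.lookup (allTys k) i)

    xs : Fin (length (allTys k) * q) → D 𝔻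
    xs = uncurry pickAt ∘ remQuot q

    picked : ∀ t j → Σ (Fin _) λ v → xs v ≡ picks t j
    picked t j = combine i j , (begin
      xs (combine i j)                    ≡⟨ cong (uncurry pickAt) (remQuot-combine i j) ⟩
      picks (List.lookup (allTys k) i) j  ≡⟨ cong (λ t → picks t j) (sym (lookup-index t∈)) ⟩
      picks t j                           ∎)
      where
      open ≡-Reasoning
      t∈ = ∈-allTys t
      i = index t∈

    open RelativisationSemantics 𝔻 xs (infiniteCandidate 𝔻 L) (infiniteCandidate-infinite 𝔻) public

    finiteCover : Ty k → List (D 𝔻)
    finiteCover t with lem {Finite (HasTy 𝔻 t)}
    ... | yes (ds , _) = ds
    ... | no  _        = []

    finiteCover-or-infinite : ∀ t {d} → HasTy 𝔻 t d → d ∈ finiteCover t ⊎ ¬ Finite (HasTy 𝔻 t)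
    finiteCover-or-infinite t t[d] with lem {Finite (HasTy 𝔻 t)}
    ... | yes (ds , covers) = inj₁ (covers _ t[d])
    ... | no  ¬fin          = inj₂ ¬fin

    generated⇒¬missing : ∀ {d} → Generated d → ¬ Missing 𝔼⊆𝔻 d
    generated⇒¬missing g missing = missing (⟨ _ , g ⟩ , refl)

    rich : Rich L q 𝔼⊆𝔻
    rich = record { finitelyMissing = finitelyMissing ; copies = copies }
      where
      finitelyMissing : HasInf L → Finite (Missing 𝔼⊆𝔻)
      finitelyMissing hi = concatMap finiteCover (allTys k) , λ d missing →
        [ (λ d∈ → ∈-concatMap⁺ finiteCover (Any.map (λ { refl → d∈ }) (∈-allTys (typeOf 𝔻 d))))
        , (λ ¬fin → let (h , t∈S) = infiniteCandidate-complete 𝔻 hi ¬fin in ⊥-elim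
            (generated⇒¬missing (inj₂ ((h , typeOf 𝔻 d) , t∈S , hasTy-typeOf 𝔻 d)) missing)) ]′
        (finiteCover-or-infinite (typeOf 𝔻 d) (hasTy-typeOf 𝔻 d))

      copies : ∀ d → Missing 𝔼⊆𝔻 d →
               Σ (Fin q → D 𝔼) λ s → Injective _≡_ _≡_ s × ∀ i → SameTy 𝔻 (proj₁ (s i)) d
      copies d missing with proj₂ (exhaust-or-inject (HasTy 𝔻 (typeOf 𝔻 d)) d₀ q)
      ... | inj₁ exhausts =
        let (j , pj≡d) = exhausts d (hasTy-typeOf 𝔻 d) ; (v , xv≡pj) = picked (typeOf 𝔻 d) j in
        ⊥-elim (generated⇒¬missing (inj₁ (v , trans xv≡pj pj≡d)) missing)
      ... | inj₂ (picks-injective , picks-typed) =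
        (λ j → ⟨ picks (typeOf 𝔻 d) j , inj₁ (picked (typeOf 𝔻 d) j) ⟩)
        , (λ same → picks-injective (cong proj₁ same))
        , λ j → hasTy⇒sameTy 𝔻 (typeOf 𝔻 d) (picks-typed j) (hasTy-typeOf 𝔻 d)

  module _ {L : Lang} {k : ℕ} (φ : Sentence L k) (𝔻 : Model k) where
    preserved⇒⊗ : PreservedUnderSubmodels φ → 𝔻 ⊨ φ → 𝔻 ⊨ φ ⊗
    preserved⇒⊗ preserved 𝔻⊨φ =
      from (sat-truthValue 𝔻 _) (to (sat-empty ∅ᴹ (λ ()) φ noVars) ∅ᴹ⊨φ)
      , from (sat-⋀ 𝔻 (candidates L k) (clause φ)) (λ S _ → sat-clause S)
      where
      ∅ᴹ⊨φ : ∅ᴹ ⊨ φ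
      ∅ᴹ⊨φ = preserved 𝔻 ∅ᴹ (∅ᴹ-submodel 𝔻) 𝔻⊨φ

      sat-clause : ∀ S → 𝔻 ⊨ clause φ S
      sat-clause S with lem {𝔻 ⊨ someFinite S}
      ... | yes some-finite = inj₁ some-finite
      ... | no  none-finite = inj₂ (from (sat-∀ⁿ 𝔻 (bound φ) _) λ xs →
        let open RelativisationSemantics 𝔻 xs S S-infinite
        in to (sat-rel φ (λ _ → refl)) (preserved 𝔻 𝔼 𝔼⊆𝔻 𝔻⊨φ))
        where
        S-infinite : ∀ {p} → p ∈ S → ¬ Finite (HasTy 𝔻 (proj₂ p))
        S-infinite p∈S fin = none-finite (from (sat-someFinite 𝔻 S) (_ , p∈S , fin))

    ⊗⇒sat : 𝔻 ⊨ φ ⊗ → 𝔻 ⊨ φ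
    ⊗⇒sat (s-empty , s-clauses) with lem {D 𝔻}
    ... | no ∅ = from (sat-empty 𝔻 ∅ φ noVars) (to (sat-truthValue 𝔻 _) s-empty)
    ... | yes d₀ with to (sat-⋀ 𝔻 (candidates L k) (clause φ)) s-clauses
                         (infiniteCandidate 𝔻 L) (infiniteCandidate-∈ 𝔻 L)
    ...   | inj₁ some-finite = ⊥-elim (infiniteCandidate-¬someFinite 𝔻 L some-finite)
    ...   | inj₂ s-all = to (sat-rich rich φ ≤-refl {noVars} {noVars} λ ()) 𝔼⊨φ
      where
      open Witnesses {L} 𝔻 d₀ (qrank φ)

      𝔼⊨φ : 𝔼 ⊨ φ
      𝔼⊨φ = from (sat-rel φ λ _ → refl) (to (sat-∀ⁿ 𝔻 (bound φ) _) s-all xs)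

open Classical using (universal⇒preserved; preserved⇒⊗; ⊗⇒sat)

proposition6p7 : (L : Lang) (k : ℕ) →
    Σ (Sentence L k → Sentence L k) λ tr →
      ((φ : Sentence L k) → Universal (tr φ)) ×
      (ExcludedMiddle 0ℓ → (φ : Sentence L k) →
        PreservedUnderSubmodels φ ⇔ (φ ≣ tr φ))
proposition6p7 L k = _⊗ , universal-⊗ , λ lem φ → mk⇔
  (λ preserved 𝔻 → mk⇔ (preserved⇒⊗ lem φ 𝔻 preserved) (⊗⇒sat lem φ 𝔻))
  (λ φ≣φ⊗ 𝔻 𝔻' sub 𝔻⊨φ → from (φ≣φ⊗ 𝔻')
    (universal⇒preserved lem (universal-⊗ φ) 𝔻 𝔻' sub (to (φ≣φ⊗ 𝔻) 𝔻⊨φ)))
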